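{- Let $G, H$ be graphs and let $U \subset V(H)$ be a subset of $V(H)$. Then $$I(G[H;U]) = \mathcal{Z}^*_{I(G)}\bigl(I(H), I(H \setminus U)\bigr),$$ where $H \setminus U$ is the graph defined by $V(H \setminus U)=V(H)\setminus U$ and $E(H \setminus U)=\{\{u,v\} \in E(H) : u,v \notin U\}$.
   Context: All graphs are finite and simple: $G=(V(G),E(G))$ with $V(G)$ a finite set and $E(G)\subset\{e\subset V(G) : |e|=2\}$. The independence complex $I(G)$ is the simplicial complex on $V(G)$ whose simplices are the independent sets of $G$, i.e. the sets $\sigma\subset V(G)$ with $\{u,v\}\notin E(G)$ for all $u,v\in\sigma$. For graphs $G,H$ and $U\subset V(H)$, the graph $G[H;U]$ has vertex set $V(G)\times V(H)$, and $\{(u_1,v_1),(u_2,v_2)\}$ is an edge if and only if either $u_1=u_2$ and $\{v_1,v_2\}\in E(H)$, or $\{u_1,u_2\}\in E(G)$ and $v_1,v_2\in U$. The join of a finite family of simplicial complexes $\{K_i\}$ is $\{\sigma\subset\bigsqcup_{i}V(K_i) : \sigma\cap V(K_i)\in K_i \text{ for all } i\}$. For a simplicial complex $M$ with finite vertex set $V(M)$ and a simplicial complex $K$ with a subcomplex $L$, the polyhedral join $\mathcal{Z}^*_M(K,L)$ is the subcomplex $\bigcup_{S\in M}\left(\text{join over } i\in V(M) \text{ of } X^S_i\right)$ of the join of copies of $K$ indexed by $V(M)$, where $X^S_i$ is the $i$-th copy of $K$ if $i\in S$ and the $i$-th copy of $L$ if $i\notin S$. Its vertex set $\bigsqcup_{i\in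 V(M)}V(K)$ is identified with $V(M)\times V(K)$; here, with $V(G)\times V(H)$. -}

module Defs where

open import Data.Bool.Base using (Bool; true; false; _∧_; not; if_then_else_; T)
open import Data.Bool.Properties using (T-∧)
open import Data.List.Base using (List; cartesianProduct)
import Data.List.Membership.Propositional as List
open import Data.List.Membership.Propositional.Properties using (∈-cartesianProduct⁺)
open import Data.Product.Base using (∃; ∃-syntax; _×_; _,_; proj₁; proj₂)
open import Data.Sum.Base using (_⊎_; inj₁; inj₂)
open import Function.Base using (_∘_)
open import Function.Bundles using (Equivalence)
open import Level using (0ℓ)
open import Relation.Binary.Core using (Rel)
open import Relation.Binary.PropositionalEquality using (_≡_; refl; sym; _≗_)
open import Relation.Nullary using (¬_)
import Relation.Unary as Unary
open Unary using (Pred)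

open Equivalence using (to; from)

private
  variable
    A B : Set

------------------------------------------------------------------------
-- Finite sets

-- The finite sets under consideration are subsets of an arbitrary ambient
-- type, so that V(H) ∖ U and V(H) live in the same place and inclusions
-- and equalities of vertex sets can be expressed without coercions.
-- Subsets are decidable; a subset is finite when a list contains all of
-- its elements.  Equality of subsets is pointwise.

Subset : Set → Set
Subset A = A → Bool

infix 4 _∈_ _∉_ _⊆_

_∈_ : A → Subset A → Set
v ∈ σ = T (σ v)

_∉_ : A → Subset A → Set
v ∉ σ = ¬ (v ∈ σ)

_⊆_ : Subset A → Subset A → Set
σ ⊆ τ = (T ∘ σ) Unary.⊆ (T ∘ τ)

∅ : Subset A
∅ _ = false

infixr 7 _⊠_
infixl 6 _─_

_⊠_ : Subset A → Subset B → Subset (A × B)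
(V ⊠ W) (u , v) = V u ∧ W v

_─_ : Subset A → Subset A → Subset A
(V ─ W) v = V v ∧ not (W v)

Finite : Subset A → Set
Finite {A} V = ∃[ xs ] (∀ {v : A} → v ∈ V → v List.∈ xs)

⊠-finite : {V : Subset A} {W : Subset B} → Finite V → Finite W → Finite (V ⊠ W)
⊠-finite (xs , V⊆xs) (ys , W⊆ys) = cartesianProduct xs ys , λ p →
  let (u∈V , v∈W) = to T-∧ p in ∈-cartesianProduct⁺ (V⊆xs u∈V) (W⊆ys v∈W)

─-⊆ : (V W : Subset A) → V ─ W ⊆ V
─-⊆ V W = proj₁ ∘ to T-∧

∈-─ : (V W : Subset A) {v : A} → v ∈ V → v ∉ W → v ∈ V ─ W
∈-─ V W {v} v∈V v∉W with V v | W v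
... | true | false = _
... | true | true  = v∉W _

------------------------------------------------------------------------
-- Graphs

-- E u v means that {u , v} is an edge; symmetry and irreflexivity say that
-- edges are unordered pairs of distinct vertices.

record Graph (A : Set) : Set₁ where
  field
    V        : Subset A
    V-finite : Finite V
    E        : Rel A 0ℓ
    E-vertex : ∀ {u v} → E u v → u ∈ V
    E-sym    : ∀ {u v} → E u v → E v u
    E-irrefl : ∀ {v} → ¬ E v v

open Graph

-- The graph G[H;U].

infix 8 _[_⨾_]

_[_⨾_] : Graph A → Graph B → Subset B → Graph (A × B)
V        (G [ H ⨾ U ]) = V G ⊠ V H
V-finite (G [ H ⨾ U ]) = ⊠-finite {V = V G} {W = V H} (V-finite G) (V-finite H)
E        (G [ H ⨾ U ]) p@(u₁ , v₁) q@(u₂ , v₂) =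
  p ∈ V G ⊠ V H × q ∈ V G ⊠ V H ×
  ((u₁ ≡ u₂ × E H v₁ v₂) ⊎ (E G u₁ u₂ × v₁ ∈ U × v₂ ∈ U))
E-vertex (G [ H ⨾ U ]) = proj₁
E-sym    (G [ H ⨾ U ]) (p , q , inj₁ (u₁≡u₂ , e))       = q , p , inj₁ (sym u₁≡u₂ , E-sym H e)
E-sym    (G [ H ⨾ U ]) (p , q , inj₂ (e , v₁∈U , v₂∈U)) = q , p , inj₂ (E-sym G e , v₂∈U , v₁∈U)
E-irrefl (G [ H ⨾ U ]) (_ , _ , inj₁ (_ , e)) = E-irrefl H e
E-irrefl (G [ H ⨾ U ]) (_ , _ , inj₂ (e , _)) = E-irrefl G e

infixl 8 _∖_

_∖_ : Graph A → Subset A → Graph A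
V        (H ∖ U) = V H ─ U
V-finite (H ∖ U) = proj₁ (V-finite H) , λ v∈ → proj₂ (V-finite H) (─-⊆ (V H) U v∈)
E        (H ∖ U) u v = E H u v × u ∉ U × v ∉ U
E-vertex (H ∖ U) (e , u∉U , _) = ∈-─ (V H) U (E-vertex H e) u∉U
E-sym    (H ∖ U) (e , u∉U , v∉U) = E-sym H e , v∉U , u∉U
E-irrefl (H ∖ U) (e , _) = E-irrefl H e

------------------------------------------------------------------------
-- Simplicial complexes

-- The empty simplex is always present.  A vertex is not required to span
-- a simplex, although in an independence complex it always does.

record Complex (A : Set) : Set₁ where
  field
    vertices        : Subset A
    vertices-finite : Finite vertices
    simplices       : Pred (Subset A) 0ℓ
    simplex-⊆       : ∀ {σ} → simplices σ → σ ⊆ vertices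
    ∅-simplex       : simplices ∅
    down-closed     : ∀ {σ τ} → τ ⊆ σ → simplices σ → simplices τ

open Complex

infix 4 _≋_ _≼_

-- Equality of complexes.

_≋_ : Complex A → Complex A → Set
K ≋ L = vertices K ≗ vertices L × simplices K Unary.≐ simplices L

-- L ≼ K: L is a subcomplex of K.

_≼_ : Complex A → Complex A → Set
L ≼ K = vertices L ⊆ vertices K × simplices L Unary.⊆ simplices K

I : Graph A → Complex A
vertices        (I G) = V G
vertices-finite (I G) = V-finite G
simplices       (I G) σ = σ ⊆ V G × (∀ {u v} → u ∈ σ → v ∈ σ → ¬ E G u v)
simplex-⊆       (I G) = proj₁
∅-simplex       (I G) = (λ ()) , λ ()
down-closed     (I G) τ⊆σ (σ⊆V , indep) =
  (λ u∈τ → σ⊆V (τ⊆σ u∈τ)) , λ u∈τ v∈τ → indep (τ⊆σ u∈τ) (τ⊆σ v∈τ)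

I-∖-≼ : (H : Graph A) (U : Subset A) → I (H ∖ U) ≼ I H
I-∖-≼ H U = ─-⊆ (V H) U , λ {σ} (σ⊆ , indep) →
  (λ u∈σ → ─-⊆ (V H) U (σ⊆ u∈σ)) ,
  λ u∈σ v∈σ e → indep u∈σ v∈σ
    (e , ∉U (σ⊆ u∈σ) , ∉U (σ⊆ v∈σ))
  where
  ∉U : ∀ {v} → v ∈ V H ─ U → v ∉ U
  ∉U {v} v∈ with V H v | U v
  ... | true | false = λ ()

------------------------------------------------------------------------
-- Joins and polyhedral joins

-- The part of σ in the i-th summand of a disjoint union of copies of B.

slice : Subset (A × B) → A → Subset B
slice σ i v = σ (i , v)

-- Simplices of the join of the complexes X i over i ∈ J; the disjoint union
-- of their vertex sets is realised inside A × B.  The values of X outside J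
-- play no role.

JoinSimplex : Subset A → (A → Complex B) → Pred (Subset (A × B)) 0ℓ
JoinSimplex J X σ =
  (∀ {i v} → (i , v) ∈ σ → i ∈ J × v ∈ vertices (X i)) ×
  (∀ {i} → i ∈ J → simplices (X i) (slice σ i))

-- The i-th factor indexed by S: K if i ∈ S and L otherwise.

factor : Complex B → Complex B → Subset A → A → Complex B
factor K L S i = if S i then K else L

𝒵* : (M : Complex A) (K L : Complex B) → L ≼ K → Complex (A × B)
vertices        (𝒵* M K L L≼K) = vertices M ⊠ vertices K
vertices-finite (𝒵* M K L L≼K) =
  ⊠-finite {V = vertices M} {W = vertices K} (vertices-finite M) (vertices-finite K)
simplices       (𝒵* M K L L≼K) σ =
  ∃[ S ] (simplices M S × JoinSimplex (vertices M) (factor K L S) σ)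
simplex-⊆       (𝒵* M K L L≼K) (S , _ , σ⊆ , _) {i , v} p with S i | σ⊆ {i} {v} p
... | true  | i∈M , v∈K = from T-∧ (i∈M , v∈K)
... | false | i∈M , v∈L = from T-∧ (i∈M , proj₁ L≼K v∈L)
∅-simplex       (𝒵* M K L L≼K) =
  ∅ , ∅-simplex M , (λ ()) , λ _ → ∅-simplex L
down-closed     (𝒵* M K L L≼K) τ⊆σ (S , S∈M , σ⊆ , slices) =
  S , S∈M , (λ p → σ⊆ (τ⊆σ p)) ,
  λ {i} i∈M → down-closed (factor K L S i) (λ p → τ⊆σ p) (slices i∈M)

{-# OPTIONS --safe #-}
module Submission where

open import Data.Bool.Base using (true; false; _∧_)
open import Data.Bool.ListAction using (any)
open import Data.Bool.Properties using (T-∧)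
open import Data.List.Membership.Propositional using (find; lose)
open import Data.List.Relation.Unary.Any.Properties using (any⁺; any⁻)
open import Data.Product.Base using (∃-syntax; _×_; _,_; proj₁; proj₂)
open import Data.Sum.Base using (inj₁; inj₂)
open import Function.Base using (_∘_; id)
open import Function.Bundles using (Equivalence)
open import Relation.Binary.PropositionalEquality using (refl)
open import Relation.Nullary using (¬_; contradiction)
import Relation.Unary as Unary

open import Defs

open Complex
open Equivalence using (to; from)
open Graph

-- For an independent set σ of G[H;U] take S = { u : σ meets {u} × U }: it is
-- independent because an edge u₁u₂ of G joins (u₁ , v₁) and (u₂ , v₂) whenever
-- v₁ , v₂ ∈ U, and over each u ∉ S the slice of σ avoids U.  Conversely, a
-- simplex of the polyhedral join indexed by S has independent slices and meets
-- {u} × U only for u ∈ S, which rules out both kinds of edges of G[H;U].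

private
  variable
    A B : Set

∈-─⇒∉ : (V W : Subset A) {v : A} → v ∈ V ─ W → v ∉ W
∈-─⇒∉ V W {v} v∈ with V v | W v
... | true | false = id

-- `factor K L S i` is stuck on the Boolean `S i`. An arbitrary motive `P` confines the case split
-- to this one place and hands each branch the matching fact about `i` and `S`.
factor-elim : (P : Complex B → Set) (K L : Complex B) (S : Subset A) (i : A) →
              (i ∈ S → P K) → (i ∉ S → P L) → P (factor K L S i)
factor-elim P K L S i k l with S i
... | true  = k _
... | false = l id

-- Searching a list of the elements of V makes the projection of σ ∩ (A × W)
-- Boolean-valued, as a Subset has to be; it is correct when σ ⊆ A × V.
meeting : {V : Subset B} → Finite V → Subset B → Subset (A × B) → Subset A
meeting (xs , _) W σ u = any (λ v → σ (u , v) ∧ W v) xs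

∈-meeting⁺ : {V W : Subset B} (fin : Finite V) (σ : Subset (A × B)) {u : A} {v : B} →
             v ∈ V → (u , v) ∈ σ → v ∈ W → u ∈ meeting {V = V} fin W σ
∈-meeting⁺ (_ , V⊆xs) σ v∈V p∈σ v∈W =
  any⁺ _ (lose (V⊆xs v∈V) (from T-∧ (p∈σ , v∈W)))

∈-meeting⁻ : {V W : Subset B} (fin : Finite V) (σ : Subset (A × B)) {u : A} →
             u ∈ meeting {V = V} fin W σ → ∃[ v ] ((u , v) ∈ σ × v ∈ W)
∈-meeting⁻ (xs , _) σ u∈ =
  let (v , _ , q) = find (any⁻ _ xs u∈) in v , to T-∧ q

module _ (G : Graph A) (H : Graph B) (U : Subset B) where

  private
    Z : Complex (A × B)
    Z = 𝒵* (I G) (I H) (I (H ∖ U)) (I-∖-≼ H U)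

  independent⇒polyhedral : simplices (I (G [ H ⨾ U ])) Unary.⊆ simplices Z
  independent⇒polyhedral {σ} (σ⊆ , indep) = S , (S⊆ , S-indep) , vertex , slices
    where
    S : Subset A
    S = meeting {V = V H} (V-finite H) U σ

    ∈G : ∀ {u v} → (u , v) ∈ σ → u ∈ V G
    ∈G = proj₁ ∘ to T-∧ ∘ σ⊆

    ∈H : ∀ {u v} → (u , v) ∈ σ → v ∈ V H
    ∈H {u} = proj₂ ∘ to (T-∧ {V G u}) ∘ σ⊆

    S⊆ : S ⊆ V G
    S⊆ u∈S = ∈G (proj₁ (proj₂ (∈-meeting⁻ (V-finite H) σ u∈S)))

    S-indep : ∀ {u₁ u₂} → u₁ ∈ S → u₂ ∈ S → ¬ E G u₁ u₂
    S-indep u₁∈S u₂∈S e =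
      let (_ , p , v₁∈U) = ∈-meeting⁻ (V-finite H) σ u₁∈S
          (_ , q , v₂∈U) = ∈-meeting⁻ (V-finite H) σ u₂∈S
      in indep p q (σ⊆ p , σ⊆ q , inj₂ (e , v₁∈U , v₂∈U))

    -- Contrapositive of `∈-meeting⁺`: if `v` were in `U`, the point `(u , v)` would put `u` into
    -- `S`.
    ∈H∖U : ∀ {u v} → u ∉ S → (u , v) ∈ σ → v ∈ V H ─ U
    ∈H∖U u∉S p = ∈-─ (V H) U (∈H p) (u∉S ∘ ∈-meeting⁺ (V-finite H) σ (∈H p) p)

    vertex : ∀ {u v} → (u , v) ∈ σ →
             u ∈ V G × v ∈ vertices (factor (I H) (I (H ∖ U)) S u)
    vertex {u} {v} p = ∈G p ,
      factor-elim (λ X → v ∈ vertices X) (I H) (I (H ∖ U)) S u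
        (λ _ → ∈H p)
        (λ u∉S → ∈H∖U u∉S p)

    slice-indep : ∀ {u v₁ v₂} → (u , v₁) ∈ σ → (u , v₂) ∈ σ → ¬ E H v₁ v₂
    slice-indep p q e = indep p q (σ⊆ p , σ⊆ q , inj₁ (refl , e))

    slices : ∀ {u} → u ∈ V G →
             simplices (factor (I H) (I (H ∖ U)) S u) (slice σ u)
    slices {u} _ = factor-elim (λ X → simplices X (slice σ u)) (I H) (I (H ∖ U)) S u
      (λ _ → ∈H , slice-indep)
      -- Edges of `H ∖ U` are edges of `H`, so independence in `H` suffices.
      (λ u∉S → ∈H∖U u∉S , λ p q → slice-indep p q ∘ proj₁)

  polyhedral⇒independent : simplices Z Unary.⊆ simplices (I (G [ H ⨾ U ]))
  polyhedral⇒independent {σ} σ∈Z@(S , (_ , S-indep) , vertex , slices) =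
    simplex-⊆ Z σ∈Z , indep
    where
    -- Both possible factors are subcomplexes of `I H`. This excludes edges within a single copy of
    -- `H`.
    slice-simplex : ∀ {u} → u ∈ V G → simplices (I H) (slice σ u)
    slice-simplex {u} u∈G =
      -- The motive is an implication because the type of `slices u∈G` itself depends on the factor.
      factor-elim (λ X → simplices X (slice σ u) → simplices (I H) (slice σ u))
        (I H) (I (H ∖ U)) S u
        (λ _ → id) (λ _ → proj₂ (I-∖-≼ H U)) (slices u∈G)

    -- Otherwise the factor over `u` would be `I (H ∖ U)`, which has no vertex in `U`.
    ∈S : ∀ {u v} → (u , v) ∈ σ → v ∈ U → u ∈ S
    ∈S {u} {v} p v∈U =
      factor-elim (λ X → v ∈ vertices X → u ∈ S) (I H) (I (H ∖ U)) S u
        (λ u∈S _ → u∈S)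
        (λ _ v∈ → contradiction v∈U (∈-─⇒∉ (V H) U v∈))
        (proj₂ (vertex p))

    indep : ∀ {p q} → p ∈ σ → q ∈ σ → ¬ E (G [ H ⨾ U ]) p q
    indep p q (_ , _ , inj₁ (refl , e)) =
      proj₂ (slice-simplex (proj₁ (vertex p))) p q e
    indep p q (_ , _ , inj₂ (e , v₁∈U , v₂∈U)) =
      S-indep (∈S p v₁∈U) (∈S q v₂∈U) e

proposition5p4 : {A B : Set} (G : Graph A) (H : Graph B) (U : Subset B) → U ⊆ Graph.V H →
    I (G [ H ⨾ U ]) ≋ 𝒵* (I G) (I H) (I (H ∖ U)) (I-∖-≼ H U)
proposition5p4 G H U _ =
  -- Both vertex sets unfold to `V G ⊠ V H`.
  (λ _ → refl) , independent⇒polyhedral G H U , polyhedral⇒independent G H U
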